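{- Let $G$ be a finite simple triangle-free graph with at least one edge. Then for every integer $n\ge 3$, $$\chi_i'(S_G^3)\le \chi_i'(S_G^n)\le \chi_i'(S_G^3)+1.$$ Moreover, writing $k=\chi_i'(S_G^3)$, we have $\chi_i'(S_G^n)=\chi_i'(S_G^3)$ for all $n\ge 3$ whenever at least one of the following holds: (i) there is an injective edge $k$-coloring of $S_G^3$ such that every vertex of $S_G^3$ incident to an edge of color $k$ is at distance at least $3$ (in $S_G^3$) from every extreme vertex $(u,u,u)$, $u\in V(G)$; or (ii) $G$ is bipartite with bipartition $V(G)=A\cup B$, and there is an injective edge $k$-coloring of $S_G^3$ such that for every $u\in A$ all edges incident with the extreme vertex $(u,u,u)$ receive color $k$, and every vertex of $S_G^3$ incident to an edge of color $k$ is at distance at least $2$ (in $S_G^3$) from every extreme vertex $(v,v,v)$ with $v\in B$.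
   Context: For a graph $H$ with at least one edge, an injective edge $k$-coloring is a map $c:E(H)\to\{1,\dots,k\}$ such that whenever $e_1=xy$, $e_2=yz$, $e_3=zu$ are edges of $H$ with $x,y,z$ distinct and $u\notin\{y,z\}$ (the case $u=x$ being allowed), we have $c(e_1)\ne c(e_3)$. The injective chromatic index $\chi_i'(H)$ is the least $k$ for which such a coloring exists. For a graph $G$ and positive integer $n$, the generalized Sierpiński graph $S_G^n$ has vertex set $V(G)^n$, and $(u_1,\dots,u_n)$, $(v_1,\dots,v_n)$ are adjacent if and only if there is $d\in\{1,\dots,n\}$ with $u_i=v_i$ for $i<d$, $u_dv_d\in E(G)$, and $u_i=v_d$, $v_i=u_d$ for all $i>d$. The extreme vertices of $S_G^n$ are the vertices $(u,\dots,u)$, $u\in V(G)$. -}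

module Defs where

open import Data.Empty using (⊥-elim)
open import Data.Fin as Fin using (Fin; toℕ; fromℕ; fromℕ<; inject₁; combine)
open import Data.Fin.Properties as Finₚ using (any?; all?; *↔×; 1↔⊤; combine-injective;
  toℕ-injective; toℕ<n; toℕ-inject₁; toℕ-fromℕ<)
open import Data.Nat using (ℕ; zero; suc; _≤_; _<_; _^_; _*_; z≤n; s≤s; _<?_)
import Data.Nat.Properties as ℕₚ
open import Data.Product using (Σ; ∃; _×_; _,_; proj₁; proj₂; swap)
open import Data.Product.Function.NonDependent.Propositional using (_×-↔_)
open import Data.Sum using (_⊎_; inj₁; inj₂)
open import Data.Unit using (tt)
open import Data.Vec using (Vec; []; _∷_; lookup; replicate; tabulate; uncons)
open import Data.Vec.Properties using (lookup∘tabulate)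
open import Function using (_∘_)
open import Function.Bundles using (_↔_; mk↔ₛ′; module Inverse)
open import Function.Construct.Composition using (_↔-∘_)
open import Function.Construct.Identity using (↔-id)
open import Function.Construct.Symmetry using (↔-sym)
open import Relation.Binary using (Symmetric; Decidable; DecidableEquality)
open import Relation.Binary.PropositionalEquality
  using (_≡_; _≢_; refl; sym; trans; cong; cong₂; subst)
open import Relation.Nullary using (Dec; yes; no; ¬_)
open import Relation.Nullary.Decidable using (map′; _×-dec_; _→-dec_; ¬?)
import Relation.Unary as U

module _ {A : Set} {n : ℕ} (fin : A ↔ Fin n) where
  open Inverse fin

  ≟-finite : DecidableEquality A
  ≟-finite x y = map′
    (λ eq → trans (sym (strictlyInverseʳ x)) (trans (cong from eq) (strictlyInverseʳ y)))
    (cong to) (to x Finₚ.≟ to y)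

  any-finite? : {P : A → Set} → U.Decidable P → Dec (∃ P)
  any-finite? {P} P? = map′
    (λ (i , p) → from i , p)
    (λ (x , p) → to x , subst P (sym (strictlyInverseʳ x)) p)
    (any? (P? ∘ from))

  all-finite? : {P : A → Set} → U.Decidable P → Dec (∀ x → P x)
  all-finite? {P} P? = map′
    (λ p x → subst P (strictlyInverseʳ x) (p (to x)))
    (λ p i → p (from i))
    (all? (P? ∘ from))

Vec-finite : {A : Set} {m : ℕ} → A ↔ Fin m → ∀ n → Vec A n ↔ Fin (m ^ n)
Vec-finite fin zero = ↔-sym 1↔⊤ ↔-∘ mk↔ₛ′ (λ _ → tt) (λ _ → []) (λ _ → refl) (λ { [] → refl })
Vec-finite fin (suc n) =
  ↔-sym *↔× ↔-∘ ((fin ×-↔ Vec-finite fin n) ↔-∘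
    mk↔ₛ′ uncons (λ (x , xs) → x ∷ xs) (λ _ → refl) (λ { (_ ∷ _) → refl }))

-- Adj? loses no generality: classically every relation is decidable.
record Graph : Set₁ where
  field
    Vertex  : Set
    order   : ℕ
    finite  : Vertex ↔ Fin order
    Adj     : Vertex → Vertex → Set
    Adj?    : Decidable Adj
    Adj-sym : Symmetric Adj
    irrefl  : ∀ x → ¬ Adj x x

open Graph public

HasEdge : Graph → Set
HasEdge H = ∃ λ x → ∃ λ y → Adj H x y

TriangleFree : Graph → Set
TriangleFree H = ∀ x y z → Adj H x y → Adj H y z → ¬ Adj H z x

record Bipartition (H : Graph) : Set₁ where
  field
    A B           : Vertex H → Set
    cover         : ∀ v → A v ⊎ B v
    disjoint      : ∀ v → A v → ¬ B v
    A-independent : ∀ u v → A u → A v → ¬ Adj H u v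
    B-independent : ∀ u v → B u → B v → ¬ Adj H u v

data Walk (H : Graph) : Vertex H → Vertex H → ℕ → Set where
  nil  : ∀ {x} → Walk H x x 0
  cons : ∀ {x y z ℓ} → Adj H x y → Walk H y z ℓ → Walk H x z (suc ℓ)

-- The distance is the least length of a walk, and is infinite if there is no
-- walk; so "distance at least r" says that no walk is shorter than r.
DistanceAtLeast : (H : Graph) → ℕ → Vertex H → Vertex H → Set
DistanceAtLeast H r x y = ∀ ℓ → Walk H x y ℓ → r ≤ ℓ

-- colour-sym, taken twice, also makes colour independent of the proof of
-- adjacency, so that colour is a map on undirected edges.  In injective,
-- x ≢ y, y ≢ z and u ≢ z are omitted: they follow from irreflexivity.
record InjectiveEdgeColouring (H : Graph) (k : ℕ) : Set where
  field
    colour     : ∀ x y → Adj H x y → Fin k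
    colour-sym : ∀ x y (e : Adj H x y) (e′ : Adj H y x) → colour x y e ≡ colour y x e′
    injective  : ∀ x y z u (e₁ : Adj H x y) (e₂ : Adj H y z) (e₃ : Adj H z u) →
                 x ≢ z → u ≢ y → colour x y e₁ ≢ colour z u e₃

-- The colours 1,…,k are represented by Fin k, so i : Fin k stands for the
-- colour suc (toℕ i).
HasLastColour : ∀ {H k} → InjectiveEdgeColouring H k → ∀ x y → Adj H x y → Set
HasLastColour {k = k} c x y e = suc (toℕ (InjectiveEdgeColouring.colour c x y e)) ≡ k

IsLeast : (ℕ → Set) → ℕ → Set
IsLeast P k = P k × (∀ j → P j → k ≤ j)

least : {P : ℕ → Set} → U.Decidable P → ∀ n → P n → ∃ (IsLeast P)
least P? zero    p = zero , p , λ _ _ → z≤n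
least {P} P? (suc n) p with P? zero
... | yes p₀ = zero , p₀ , λ _ _ → z≤n
... | no ¬p₀ with least (P? ∘ suc) n p
...   | k , pk , min = suc k , pk , below
  where
  below : ∀ j → P j → suc k ≤ j
  below zero    q = ⊥-elim (¬p₀ q)
  below (suc j) q = s≤s (min j q)

-- Distinct unordered pairs of vertices get distinct colours.
trivialColouring : (H : Graph) → InjectiveEdgeColouring H (order H * order H)
trivialColouring H = record
  { colour     = λ x y _ → pair (to x) (to y)
  ; colour-sym = λ x y _ _ → pair-sym (to x) (to y)
  ; injective  = λ x y z u e₁ e₂ e₃ x≢z u≢y eq →
      inj x≢z (λ { refl → irrefl H _ e₂ }) (pair-inj (to x) (to y) (to z) (to u) eq)
  }
  where
  open Inverse (finite H) using (to; from; strictlyInverseʳ)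

  pair : (i j : Fin (order H)) → Fin (order H * order H)
  pair i j with i Fin.≤? j
  ... | yes _ = combine i j
  ... | no  _ = combine j i

  pair-sym : ∀ i j → pair i j ≡ pair j i
  pair-sym i j with i Fin.≤? j | j Fin.≤? i
  ... | yes p | yes q with refl ← Finₚ.≤-antisym p q = refl
  ... | yes _ | no  _ = refl
  ... | no  _ | yes _ = refl
  ... | no  p | no  q = ⊥-elim (p (ℕₚ.<⇒≤ (ℕₚ.≰⇒> q)))

  pair-inj : ∀ i j k l → pair i j ≡ pair k l → i ≡ k ⊎ j ≡ k
  pair-inj i j k l eq with i Fin.≤? j | k Fin.≤? l
  ... | yes _ | yes _ = inj₁ (proj₁ (combine-injective i j k l eq))
  ... | yes _ | no  _ = inj₂ (proj₂ (combine-injective i j l k eq))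
  ... | no  _ | yes _ = inj₂ (proj₁ (combine-injective j i k l eq))
  ... | no  _ | no  _ = inj₁ (proj₂ (combine-injective j i l k eq))

  to-inj : ∀ {x y} → to x ≡ to y → x ≡ y
  to-inj {x} {y} eq =
    trans (sym (strictlyInverseʳ x)) (trans (cong from eq) (strictlyInverseʳ y))

  inj : ∀ {x y z} {X : Set} → x ≢ z → y ≢ z → to x ≡ to z ⊎ to y ≡ to z → X
  inj x≢z y≢z (inj₁ p) = ⊥-elim (x≢z (to-inj p))
  inj x≢z y≢z (inj₂ p) = ⊥-elim (y≢z (to-inj p))

-- Decided by searching the finitely many tables of values below suc k indexed
-- by pairs of vertices, the value k standing for a non-edge.
colourable? : (H : Graph) → U.Decidable (InjectiveEdgeColouring H)
colourable? H k = map′ fromTable toTable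
  (any-finite? (Vec-finite (Vec-finite (↔-id _) (order H)) (order H)) good?)
  where
  open Inverse (finite H) using (to; from; strictlyInverseʳ)

  Table : Set
  Table = Vec (Vec (Fin (suc k)) (order H)) (order H)

  val : Table → Vertex H → Vertex H → ℕ
  val t x y = toℕ (lookup (lookup t (to x)) (to y))

  Good : (Vertex H → Vertex H → ℕ) → Set
  Good f = ∀ x y → Adj H x y → (f x y < k × f x y ≡ f y x) ×
    (∀ z → Adj H y z → ∀ u → Adj H z u → x ≢ z → u ≢ y → f x y ≢ f z u)

  good? : (t : Table) → Dec (Good (val t))
  good? t = ∀? λ x → ∀? λ y → Adj? H x y →-dec
    ((val t x y <? k) ×-dec (val t x y ℕₚ.≟ val t y x)) ×-dec
    (∀? λ z → Adj? H y z →-dec ∀? λ u → Adj? H z u →-dec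
      (¬? (x ≟ z) →-dec (¬? (u ≟ y) →-dec ¬? (val t x y ℕₚ.≟ val t z u))))
    where
    ∀? : {P : Vertex H → Set} → U.Decidable P → Dec (∀ x → P x)
    ∀? = all-finite? (finite H)
    _≟_ : DecidableEquality (Vertex H)
    _≟_ = ≟-finite (finite H)

  fromTable : (∃ λ t → Good (val t)) → InjectiveEdgeColouring H k
  fromTable (t , good) = record
    { colour     = λ _ _ → col
    ; colour-sym = λ x y e e′ → toℕ-injective
        (trans (toℕ-col e) (trans (proj₂ (proj₁ (good x y e))) (sym (toℕ-col e′))))
    ; injective  = λ x y z u e₁ e₂ e₃ x≢z u≢y eq →
        proj₂ (good x y e₁) z e₂ u e₃ x≢z u≢y
          (trans (sym (toℕ-col e₁)) (trans (cong toℕ eq) (toℕ-col e₃)))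
    }
    where
    col : ∀ {x y} → Adj H x y → Fin k
    col {x} {y} e = fromℕ< (proj₁ (proj₁ (good x y e)))
    toℕ-col : ∀ {x y} (e : Adj H x y) → toℕ (col e) ≡ val t x y
    toℕ-col {x} {y} e = toℕ-fromℕ< (proj₁ (proj₁ (good x y e)))

  toTable : InjectiveEdgeColouring H k → ∃ λ t → Good (val t)
  toTable c = table , λ x y e →
      ( subst (_< k) (sym (val-edge e)) (toℕ<n (colour x y e))
      , trans (val-edge e) (trans (cong toℕ (colour-sym x y e (Adj-sym H e)))
          (sym (val-edge (Adj-sym H e)))) )
    , λ z e₂ u e₃ x≢z u≢y eq → injective x y z u e e₂ e₃ x≢z u≢y
        (toℕ-injective (trans (sym (val-edge e)) (trans eq (val-edge e₃))))
    where
    open InjectiveEdgeColouring c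

    entry : Vertex H → Vertex H → Fin (suc k)
    entry x y with Adj? H x y
    ... | yes e = inject₁ (colour x y e)
    ... | no  _ = fromℕ k

    entry-edge : ∀ {x y} (e : Adj H x y) → toℕ (entry x y) ≡ toℕ (colour x y e)
    entry-edge {x} {y} e with Adj? H x y
    ... | yes e′ = trans (toℕ-inject₁ (colour x y e′)) (cong toℕ
            (trans (colour-sym x y e′ (Adj-sym H e)) (sym (colour-sym x y e (Adj-sym H e)))))
    ... | no ¬e  = ⊥-elim (¬e e)

    table : Table
    table = tabulate λ i → tabulate λ j → entry (from i) (from j)

    val-edge : ∀ {x y} (e : Adj H x y) → val table x y ≡ toℕ (colour x y e)
    val-edge {x} {y} e = trans
      (cong toℕ (trans (cong (λ r → lookup r (to y)) (lookup∘tabulate _ (to x)))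
        (trans (lookup∘tabulate _ (to y))
          (cong₂ entry (strictlyInverseʳ x) (strictlyInverseʳ y)))))
      (entry-edge e)

abstract
  chromaticIndex-exists : (H : Graph) → ∃ (IsLeast (InjectiveEdgeColouring H))
  chromaticIndex-exists H = least (colourable? H) _ (trivialColouring H)

χᵢ′ : Graph → ℕ
χᵢ′ H = proj₁ (chromaticIndex-exists H)

SAdj : (G : Graph) (n : ℕ) → Vec (Vertex G) n → Vec (Vertex G) n → Set
SAdj G n u v = ∃ λ (d : Fin n) →
  (∀ i → i Fin.< d → lookup u i ≡ lookup v i) ×
  Adj G (lookup u d) (lookup v d) ×
  (∀ i → d Fin.< i → lookup u i ≡ lookup v d × lookup v i ≡ lookup u d)

Sierpiński : Graph → ℕ → Graph
Sierpiński G n = record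
  { Vertex  = Vec (Vertex G) n
  ; order   = order G ^ n
  ; finite  = Vec-finite (finite G) n
  ; Adj     = SAdj G n
  ; Adj?    = λ u v → any? λ d →
      all? (λ i → i Finₚ.<? d →-dec lookup u i ≟ lookup v i) ×-dec
      Adj? G (lookup u d) (lookup v d) ×-dec
      all? (λ i → d Finₚ.<? i →-dec
        (lookup u i ≟ lookup v d ×-dec lookup v i ≟ lookup u d))
  ; Adj-sym = λ (d , eq , e , rest) →
      d , (λ i i<d → sym (eq i i<d)) , Adj-sym G e , (λ i d<i → swap (rest i d<i))
  ; irrefl  = λ u (d , _ , e , _) → irrefl G (lookup u d) e
  }
  where
  infix 4 _≟_
  _≟_ : DecidableEquality (Vertex G)
  _≟_ = ≟-finite (finite G)

extreme : (G : Graph) (n : ℕ) → Vertex G → Vertex (Sierpiński G n)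
extreme G n u = replicate n u

FarFromExtremes : Graph → Set
FarFromExtremes G =
  Σ (InjectiveEdgeColouring S (χᵢ′ S)) λ c →
    ∀ x y (e : Adj S x y) → HasLastColour c x y e →
    ∀ u → DistanceAtLeast S 3 x (extreme G 3 u)
  where
  S : Graph
  S = Sierpiński G 3

BipartiteCondition : Graph → Set₁
BipartiteCondition G =
  Σ (Bipartition G) λ P → let open Bipartition P in
  Σ (InjectiveEdgeColouring S (χᵢ′ S)) λ c →
    (∀ u → A u → ∀ y (e : Adj S (extreme G 3 u) y) → HasLastColour c (extreme G 3 u) y e) ×
    (∀ x y (e : Adj S x y) → HasLastColour c x y e →
     ∀ v → B v → DistanceAtLeast S 2 x (extreme G 3 v))
  where
  S : Graph
  S = Sierpiński G 3

{-# OPTIONS --safe #-}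

-- The copies v·S^n of S^n inside S^(n+1) are joined by bridging edges
-- between v·t^n and t·v^n, one for each edge vt of G.  Colourings of the copies
-- and of these edges fit together as soon as, for each vt, the two stars at the
-- ends have no common colour and the colour of the edge does not occur one step
-- beyond its ends.
--
-- If a colour κ is absent up to distance 2 from the extreme vertices, which can
-- be achieved by adding one colour, recolour with κ each bridging edge together
-- with the star at one of its ends; κ is again absent near the new extremes.
--
-- In the bipartite case give the bridging edges the last colour κ.  This works
-- at the extreme vertex of u ∈ A if u has at least two neighbours, but if u is a
-- leaf, then κ may occur one step beyond.  A leaf u with neighbour w makes
-- the copy of u hang by a single bridging edge, so that it can be coloured as a
-- recoded copy of the copy of w.  A recoding making the bridging edge fit exists
-- unless the colours at w and one step beyond w both exhaust everything but κ;
-- then each of them occurs just once at w, which is rigid enough to rebuild the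
-- colouring near u.

module Submission where

open import Defs
open import Data.Empty using (⊥; ⊥-elim)
open import Data.Fin as Fin using (Fin; zero; suc; toℕ; fromℕ; inject₁)
open import Data.Fin.Permutation.Components using (transpose; transpose-inverse)
import Data.Fin.Properties as Finₚ
open import Data.Nat using (ℕ; zero; suc; _≤_; _+_; z≤n; s≤s)
import Data.Nat.Properties as ℕₚ
open import Data.Product using (Σ; ∃; _×_; _,_; proj₁; proj₂)
open import Data.Sum using (_⊎_; inj₁; inj₂)
open import Data.Vec using (Vec; []; _∷_; lookup; replicate)
open import Data.Vec.Properties using (∷-injectiveˡ; ∷-injectiveʳ; ≡-dec; lookup-replicate)
open import Function using (_∘_; id)
open import Function.Bundles using (module Inverse)
open import Relation.Binary using (DecidableEquality; Decidable)
open import Relation.Binary.PropositionalEquality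
  using (_≡_; _≢_; refl; sym; trans; cong; cong₂; subst)
open import Relation.Nullary using (Dec; yes; no; ¬_)
open import Relation.Nullary.Decidable
  using (_×-dec_; _⊎-dec_; _→-dec_; ¬?; dec-true; dec-false; decidable-stable)

-- Permutations of colours.

module _ {k : ℕ} where

  transpose-injective : ∀ (i j : Fin k) {a b} → transpose i j a ≡ transpose i j b → a ≡ b
  transpose-injective i j eq =
    trans (sym (transpose-inverse j i)) (trans (cong (transpose j i) eq) (transpose-inverse j i))

  transpose-left : ∀ (i j : Fin k) → transpose i j i ≡ j
  transpose-left i j rewrite dec-true (i Finₚ.≟ i) refl = refl

  transpose-right : ∀ (i j : Fin k) → transpose i j j ≡ i
  transpose-right i j with j Finₚ.≟ i
  ... | yes j≡i = j≡i
  ... | no  _   rewrite dec-true (j Finₚ.≟ j) refl = refl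

  transpose-other : ∀ (i j : Fin k) {a} → a ≢ i → a ≢ j → transpose i j a ≡ a
  transpose-other i j {a} a≢i a≢j
    rewrite dec-false (a Finₚ.≟ i) a≢i | dec-false (a Finₚ.≟ j) a≢j = refl

  Injection : Set
  Injection = Σ (Fin k → Fin k) λ θ → ∀ {a b} → θ a ≡ θ b → a ≡ b

  -- The second transposition moves the image of `j` to `j′` and leaves `i′` in place.
  send-two : ∀ {i j i′ j′ : Fin k} → i ≢ j → i′ ≢ j′ →
             Σ Injection λ θ → proj₁ θ i ≡ i′ × proj₁ θ j ≡ j′
  send-two {i} {j} {i′} {j′} i≢j i′≢j′ =
      ((second ∘ first) , transpose-injective i i′ ∘ transpose-injective (first j) j′)
    , trans (cong second first-i) (transpose-other (first j) j′ i′≢first-j i′≢j′)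
    , transpose-left (first j) j′
    where
    first second : Fin k → Fin k
    first  = transpose i i′
    second = transpose (first j) j′

    first-i : first i ≡ i′
    first-i = transpose-left i i′

    i′≢first-j : i′ ≢ first j
    i′≢first-j eq = i≢j (transpose-injective i i′ (trans first-i eq))

-- Adjacency by recursion on the first coordinate.

module _ (G : Graph) where

  private
    V : Set
    V = Vertex G

    infix 4 _≟_ _≟ᵛ_
    _≟_ : DecidableEquality V
    _≟_ = ≟-finite (finite G)

    _≟ᵛ_ : ∀ {n} → DecidableEquality (Vec V n)
    _≟ᵛ_ = ≡-dec _≟_

    infix 30 _^^_
    _^^_ : V → (n : ℕ) → Vec V n
    v ^^ n = replicate n v

  adj⇒≢ : ∀ {v t} → Adj G v t → v ≢ t
  adj⇒≢ e refl = irrefl G _ e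

  -- An edge lies inside a copy or is the bridging edge between the copies of `v` and `t`; case
  -- analysis on this replaces the index `d` of `SAdj`.
  E : ∀ {n} → Vec V n → Vec V n → Set
  E []      []      = ⊥
  E (v ∷ x) (t ∷ y) = (v ≡ t × E x y) ⊎ (Adj G v t × x ≡ t ^^ _ × y ≡ v ^^ _)

  E? : ∀ {n} → Decidable (E {n})
  E? []      []      = no λ ()
  E? (v ∷ x) (t ∷ y) =
    (v ≟ t ×-dec E? x y) ⊎-dec (Adj? G v t ×-dec (x ≟ᵛ t ^^ _) ×-dec (y ≟ᵛ v ^^ _))

  E-sym : ∀ {n} {x y : Vec V n} → E x y → E y x
  E-sym {x = []}    {[]}    ()
  E-sym {x = _ ∷ _} {_ ∷ _} (inj₁ (eq , e))    = inj₁ (sym eq , E-sym e)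
  E-sym {x = _ ∷ _} {_ ∷ _} (inj₂ (a , p , q)) = inj₂ (Adj-sym G a , q , p)

  E-irrefl : ∀ {n} {x : Vec V n} → ¬ E x x
  E-irrefl {x = []}    ()
  E-irrefl {x = _ ∷ _} (inj₁ (_ , e)) = E-irrefl e
  E-irrefl {x = _ ∷ _} (inj₂ (a , _)) = irrefl G _ a

  private
    lookup-const : ∀ {n t} (x : Vec V n) → (∀ i → lookup x i ≡ t) → x ≡ t ^^ n
    lookup-const []      p = refl
    lookup-const (_ ∷ x) p = cong₂ _∷_ (p zero) (lookup-const x (p ∘ suc))

  SAdj⇒E : ∀ {n} (x y : Vec V n) → SAdj G n x y → E x y
  SAdj⇒E (v ∷ x) (t ∷ y) (zero , _ , a , rest) =
    inj₂ (a , lookup-const x (λ i → proj₁ (rest (suc i) (s≤s z≤n)))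
            , lookup-const y (λ i → proj₂ (rest (suc i) (s≤s z≤n))))
  SAdj⇒E (v ∷ x) (t ∷ y) (suc d , eq , a , rest) =
    inj₁ (eq zero (s≤s z≤n) ,
      SAdj⇒E x y (d , (λ i → eq (suc i) ∘ s≤s) , a , λ i → rest (suc i) ∘ s≤s))

  E⇒SAdj : ∀ {n} (x y : Vec V n) → E x y → SAdj G n x y
  E⇒SAdj []      []      ()
  E⇒SAdj (v ∷ x) (t ∷ y) (inj₂ (a , refl , refl)) =
    zero , (λ _ ()) , a ,
    λ { zero () ; (suc i) _ → lookup-replicate i t , lookup-replicate i v }
  E⇒SAdj (v ∷ x) (t ∷ y) (inj₁ (refl , e)) with d , eq , a , rest ← E⇒SAdj x y e =
    suc d , (λ { zero _ → refl ; (suc i) (s≤s p) → eq i p }) , a ,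
    λ { zero () ; (suc i) (s≤s p) → rest i p }

  -- Short walks and the distance between extreme vertices.

  -- Walks of length at most m.
  W : ∀ {n} → ℕ → Vec V n → Vec V n → Set
  W zero    x y = x ≡ y
  W (suc m) x y = x ≡ y ⊎ ∃ λ z → E x z × W m z y

  W-refl : ∀ {n} m {x : Vec V n} → W m x x
  W-refl zero    = refl
  W-refl (suc m) = inj₁ refl

  W-suc : ∀ {n} m {x y : Vec V n} → W m x y → W (suc m) x y
  W-suc zero    refl               = inj₁ refl
  W-suc (suc m) (inj₁ eq)          = inj₁ eq
  W-suc (suc m) (inj₂ (z , e , w)) = inj₂ (z , e , W-suc m w)

  W-snoc : ∀ {n} m {x y z : Vec V n} → W m x y → E y z → W (suc m) x z
  W-snoc zero    refl               e  = inj₂ (_ , e , refl)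
  W-snoc (suc m) (inj₁ refl)        e  = inj₂ (_ , e , W-refl (suc m))
  W-snoc (suc m) (inj₂ (_ , e , w)) e′ = inj₂ (_ , e , W-snoc m w e′)

  W-sym : ∀ {n} m {x y : Vec V n} → W m x y → W m y x
  W-sym zero    eq                 = sym eq
  W-sym (suc m) (inj₁ eq)          = inj₁ (sym eq)
  W-sym (suc m) (inj₂ (z , e , w)) = W-snoc m (W-sym m w) (E-sym e)

  -- The first bridging edge on the walk starts at the extreme vertex of some `s` in the copy of
  -- `v`, and crossing it costs one step.
  W-exit : ∀ {n} m {v t} {x y : Vec V n} → W (suc m) (v ∷ x) (t ∷ y) →
           (v ≡ t × W (suc m) x y) ⊎ ∃ λ s → Adj G v s × W m x (s ^^ n)
  W-exit m (inj₁ refl) = inj₁ (refl , inj₁ refl)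
  W-exit m (inj₂ (s ∷ z , inj₂ (a , refl , refl) , w)) = inj₂ (s , a , W-refl m)
  W-exit zero (inj₂ (s ∷ z , inj₁ (refl , e) , refl)) = inj₁ (refl , inj₂ (z , e , refl))
  W-exit (suc m) (inj₂ (s ∷ z , inj₁ (refl , e) , w)) with W-exit m w
  ... | inj₁ (eq , w′)     = inj₁ (eq , inj₂ (z , e , w′))
  ... | inj₂ (s , a , w′) = inj₂ (s , a , inj₂ (z , e , w′))

  -- Crossing leads to a vertex `s ∷ v ^^ _`, which is not the target since `v ≢ t`; so two steps or
  -- more follow the visit to the extreme vertex of `s`.
  W-exit-before-extreme : ∀ {n} m {v t} {x : Vec V (suc n)} → v ≢ t →
    W (2 + m) (v ∷ x) (t ^^ (2 + n)) → ∃ λ s → Adj G v s × W m x (s ^^ suc n)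
  W-exit-before-extreme m v≢t (inj₁ refl) = ⊥-elim (v≢t refl)
  W-exit-before-extreme m v≢t (inj₂ (s ∷ z , inj₂ (a , refl , refl) , w)) = s , a , W-refl m
  W-exit-before-extreme zero v≢t (inj₂ (_ ∷ _ , inj₁ (refl , e) , inj₁ refl)) = ⊥-elim (v≢t refl)
  W-exit-before-extreme zero v≢t (inj₂ (_ ∷ _ , inj₁ (refl , e) , inj₂ (_ ∷ _ , inj₁ (refl , _) , refl))) =
    ⊥-elim (v≢t refl)
  W-exit-before-extreme zero v≢t (inj₂ (_ ∷ _ , inj₁ (refl , e) , inj₂ (_ ∷ _ , inj₂ (a , _ , eq) , refl))) =
    ⊥-elim (v≢t (sym (∷-injectiveˡ eq)))
  W-exit-before-extreme (suc m) v≢t (inj₂ (_ ∷ z , inj₁ (refl , e) , w))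
    with s , a , w′ ← W-exit-before-extreme m v≢t w = s , a , inj₂ (z , e , w′)

  Separated : ℕ → ℕ → Set
  Separated n m = ∀ v t → W m (v ^^ n) (t ^^ n) → v ≡ t

  separated-weaken : ∀ {n m} → Separated n (suc m) → Separated n m
  separated-weaken sep v t w = sep v t (W-suc _ w)

  -- Such a walk first joins two distinct extreme vertices of the starting copy and then needs two
  -- more steps.
  separated-suc : ∀ {n m} → Separated (suc n) m → Separated (2 + n) (2 + m)
  separated-suc {m = m} sep v t w with v ≟ t
  ... | yes eq = eq
  ... | no v≢t with s , a , w′ ← W-exit-before-extreme m v≢t w =
    ⊥-elim (adj⇒≢ a (sep v s w′))

  separated₂ : Separated 2 2
  separated₂ = separated-suc λ v t eq → ∷-injectiveˡ eq

  separated₃ : ∀ n → Separated (3 + n) 4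
  separated₃ zero    = separated-suc separated₂
  separated₃ (suc n) = separated-suc (separated-weaken (separated-weaken (separated₃ n)))

  -- Colourings as total functions on pairs of vertices.

  record Col (n k : ℕ) : Set where
    field
      col     : Vec V n → Vec V n → Fin k
      col-sym : ∀ {x y} → E x y → col x y ≡ col y x
      inj     : ∀ {x y z u} → E x y → E y z → E z u → x ≢ z → u ≢ y → col x y ≢ col z u

  open Col

  fromCol : ∀ {n k} → Col n k → InjectiveEdgeColouring (Sierpiński G n) k
  fromCol c = record
    { colour     = λ x y _ → col c x y
    ; colour-sym = λ x y e _ → col-sym c (SAdj⇒E x y e)
    ; injective  = λ x y z u e₁ e₂ e₃ →
        inj c (SAdj⇒E x y e₁) (SAdj⇒E y z e₂) (SAdj⇒E z u e₃)
    }

  module _ {n k} (default : Fin k) (c : InjectiveEdgeColouring (Sierpiński G n) k) where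
    open InjectiveEdgeColouring c

    -- The value `default` only fills in non-edges, on which a `Col` is unconstrained.
    extend : Vec V n → Vec V n → Fin k
    extend x y with E? x y
    ... | yes e = colour x y (E⇒SAdj x y e)
    ... | no  _ = default

    extend-colour : ∀ {x y} (e : SAdj G n x y) → extend x y ≡ colour x y e
    extend-colour {x} {y} e with E? x y
    ... | yes e′ = trans (colour-sym x y _ (Adj-sym (Sierpiński G n) {x} {y} e))
                     (sym (colour-sym x y e (Adj-sym (Sierpiński G n) {x} {y} e)))
    ... | no ¬e  = ⊥-elim (¬e (SAdj⇒E x y e))

    toCol : Col n k
    toCol = record
      { col     = extend
      ; col-sym = λ {x} {y} e →
          trans (extend-colour (E⇒SAdj x y e))
            (trans (colour-sym x y _ (E⇒SAdj y x (E-sym e)))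
              (sym (extend-colour (E⇒SAdj y x (E-sym e)))))
      ; inj     = λ {x} {y} {z} {u} e₁ e₂ e₃ x≢z u≢y eq →
          injective x y z u (E⇒SAdj x y e₁) (E⇒SAdj y z e₂) (E⇒SAdj z u e₃) x≢z u≢y
            (trans (sym (extend-colour (E⇒SAdj x y e₁)))
              (trans eq (extend-colour (E⇒SAdj z u e₃))))
      }

  restrict : ∀ {n k} → Col (suc n) k → V → Col n k
  restrict c v = record
    { col     = λ x y → col c (v ∷ x) (v ∷ y)
    ; col-sym = λ e → col-sym c (inj₁ (refl , e))
    ; inj     = λ e₁ e₂ e₃ x≢z u≢y →
        inj c (inj₁ (refl , e₁)) (inj₁ (refl , e₂)) (inj₁ (refl , e₃))
          (x≢z ∘ ∷-injectiveʳ) (u≢y ∘ ∷-injectiveʳ)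
    }

  recode : ∀ {n k l} (θ : Fin k → Fin l) → (∀ {a b} → θ a ≡ θ b → a ≡ b) → Col n k → Col n l
  recode θ θ-inj c = record
    { col     = λ x y → θ (col c x y)
    ; col-sym = λ e → cong θ (col-sym c e)
    ; inj     = λ e₁ e₂ e₃ x≢z u≢y → inj c e₁ e₂ e₃ x≢z u≢y ∘ θ-inj
    }

  -- Gluing colourings of the copies.

  -- P c v holds of the colours at the extreme vertex of v, and Q c v of those
  -- of the edges one step further away from it.
  P Q : ∀ {n k} → Col n k → V → Fin k → Set
  P {n} c v a = ∃ λ y → E (v ^^ n) y × col c (v ^^ n) y ≡ a
  Q {n} c v a = ∃ λ y → ∃ λ z → E (v ^^ n) y × E y z × z ≢ v ^^ n × col c y z ≡ a

  module Glue {n k} (sep : Separated n 1) (C : V → Col n k) (F : V → V → Fin k)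
    (F-sym : ∀ {v t} → Adj G v t → F v t ≡ F t v)
    (F∉Q   : ∀ {v t} → Adj G v t → ¬ Q (C v) t (F v t))
    (P∩P   : ∀ {v t} → Adj G v t → ∀ {a} → P (C v) t a → ¬ P (C t) v a)
    where

    ^^-injective : ∀ {v t} → v ^^ n ≡ t ^^ n → v ≡ t
    ^^-injective {v} {t} eq = sep v t (inj₁ eq)

    extremes-nonadjacent : ∀ {v t} → ¬ E (v ^^ n) (t ^^ n)
    extremes-nonadjacent {v} {t} e with refl ← sep v t (inj₂ (_ , e , refl)) = E-irrefl e

    gcol : Vec V (suc n) → Vec V (suc n) → Fin k
    gcol (v ∷ x) (t ∷ y) with v ≟ t
    ... | yes _ = col (C v) x y
    ... | no  _ = F v t

    gcol-inside : ∀ v x y → gcol (v ∷ x) (v ∷ y) ≡ col (C v) x y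
    gcol-inside v x y with v ≟ v
    ... | yes _  = refl
    ... | no v≢v = ⊥-elim (v≢v refl)

    gcol-across : ∀ {v t} x y → Adj G v t → gcol (v ∷ x) (t ∷ y) ≡ F v t
    gcol-across {v} {t} x y a with v ≟ t
    ... | yes v≡t = ⊥-elim (adj⇒≢ a v≡t)
    ... | no _    = refl

    gsym : ∀ {x y} → E x y → gcol x y ≡ gcol y x
    gsym {v ∷ x} {_ ∷ y} (inj₁ (refl , e)) =
      trans (gcol-inside v x y) (trans (col-sym (C v) e) (sym (gcol-inside v y x)))
    gsym {v ∷ x} {t ∷ y} (inj₂ (a , _)) =
      trans (gcol-across x y a) (trans (F-sym a) (sym (gcol-across y x (Adj-sym G a))))

    -- Extreme vertices are distinct and nonadjacent, so the path has at most one bridging edge.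
    -- `F∉Q` applies if it is an outer edge, `P∩P` if it is the middle one.
    ginj : ∀ {x y z u} → E x y → E y z → E z u → x ≢ z → u ≢ y → gcol x y ≢ gcol z u
    ginj {v ∷ x} {_ ∷ y} {_ ∷ z} {_ ∷ u} (inj₁ (refl , e₁)) (inj₁ (refl , e₂)) (inj₁ (refl , e₃)) x≢z u≢y eq =
      inj (C v) e₁ e₂ e₃ (x≢z ∘ cong (v ∷_)) (u≢y ∘ cong (v ∷_))
        (trans (sym (gcol-inside v x y)) (trans eq (gcol-inside v z u)))
    ginj {v ∷ x} {_ ∷ y} {_ ∷ z} {q ∷ u} (inj₁ (refl , e₁)) (inj₁ (refl , e₂)) (inj₂ (a , refl , refl)) x≢z u≢y eq =
      F∉Q a (y , x , E-sym e₂ , E-sym e₁ , x≢z ∘ cong (v ∷_) ,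
        trans (sym (col-sym (C v) e₁))
          (trans (sym (gcol-inside v x y)) (trans eq (gcol-across z u a))))
    ginj {v ∷ x} {_ ∷ y} {p ∷ z} {_ ∷ u} (inj₁ (refl , e₁)) (inj₂ (a , refl , refl)) (inj₁ (refl , e₃)) x≢z u≢y eq =
      P∩P a (x , E-sym e₁ , sym (col-sym (C v) e₁))
        (u , e₃ , sym (trans (sym (gcol-inside v x y)) (trans eq (gcol-inside p z u))))
    ginj {v ∷ x} {_ ∷ y} {p ∷ z} {q ∷ u} (inj₁ (refl , e₁)) (inj₂ (a , refl , refl)) (inj₂ (b , z≡q , refl)) x≢z u≢y eq
      with refl ← ^^-injective z≡q = u≢y refl
    ginj {v ∷ x} {t ∷ y} {_ ∷ z} {_ ∷ u} (inj₂ (a , refl , refl)) (inj₁ (refl , e₂)) (inj₁ (refl , e₃)) x≢z u≢y eq =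
      F∉Q (Adj-sym G a) (z , u , e₂ , e₃ , u≢y ∘ cong (t ∷_) ,
        trans (sym (gcol-inside t z u))
          (trans (sym eq) (trans (gcol-across x y a) (F-sym a))))
    ginj {v ∷ x} {t ∷ y} {_ ∷ z} {_ ∷ u} (inj₂ (a , refl , refl)) (inj₁ (refl , e₂)) (inj₂ (b , refl , _)) x≢z u≢y eq =
      extremes-nonadjacent e₂
    ginj {v ∷ x} {t ∷ y} {_ ∷ z} {_ ∷ u} (inj₂ (a , refl , refl)) (inj₂ (b , y≡p , refl)) e₃ x≢z u≢y eq
      with refl ← ^^-injective y≡p = x≢z refl

    glue : Col (suc n) k
    glue = record { col = gcol ; col-sym = gsym ; inj = ginj }

    -- Neither a new extreme vertex nor its neighbours meet a bridging edge.
    P-glue : ∀ {v a} → P glue v a → P (C v) v a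
    P-glue {v} (_ ∷ y , inj₁ (refl , e) , eq) = y , e , trans (sym (gcol-inside v _ y)) eq
    P-glue (_ ∷ y , inj₂ (a , p , _) , _) = ⊥-elim (adj⇒≢ a (^^-injective p))

    Q-glue : ∀ {v a} → Q glue v a → Q (C v) v a
    Q-glue {v} (_ ∷ y , _ ∷ z , inj₁ (refl , e) , inj₁ (refl , e′) , z≢ , eq) =
      y , z , e , e′ , z≢ ∘ cong (v ∷_) , trans (sym (gcol-inside v y z)) eq
    Q-glue (_ ∷ y , _ ∷ z , inj₁ (refl , e) , inj₂ (_ , refl , _) , _) =
      ⊥-elim (extremes-nonadjacent e)
    Q-glue (_ ∷ _ , _ , inj₂ (a , p , _) , _) = ⊥-elim (adj⇒≢ a (^^-injective p))

  -- Recolouring stars at extreme vertices.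

  E-triangle-free : TriangleFree G → ∀ {n} {x y z : Vec V n} → E x y → E y z → ¬ E z x
  E-triangle-free tf {x = []}    {[]}    {[]}    ()
  E-triangle-free tf {x = _ ∷ _} {_ ∷ _} {_ ∷ _} = λ where
    (inj₁ (refl , e))          (inj₁ (refl , e′))         (inj₁ (_ , e″))    → E-triangle-free tf e e′ e″
    (inj₁ (refl , e))          (inj₁ (refl , e′))         (inj₂ (a , _))     → irrefl G _ a
    (inj₁ (refl , e))          (inj₂ (a , _))             (inj₁ (refl , _))  → irrefl G _ a
    (inj₁ (refl , e))          (inj₂ (_ , refl , refl))   (inj₂ (_ , _ , refl)) → E-irrefl e
    (inj₂ (a , _))             (inj₁ (refl , e))          (inj₁ (refl , _))  → irrefl G _ a
    (inj₂ (_ , refl , refl))   (inj₁ (refl , e))          (inj₂ (_ , refl , _)) → E-irrefl e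
    (inj₂ (_ , refl , refl))   (inj₂ (_ , _ , refl))      (inj₁ (refl , e))  → E-irrefl e
    (inj₂ (a , _))             (inj₂ (b , _))             (inj₂ (d , _))     → tf _ _ _ a b d

  Far : ∀ {n k} → Col n k → Fin k → V → Set
  Far {n} c κ v = ∀ z u → W 2 (v ^^ n) z → E z u → col c z u ≢ κ

  module Recolour (tf : TriangleFree G) {n k} (sep : Separated n 3)
    (c : Col n k) (κ : Fin k) (far : ∀ v → Far c κ v)
    (D : V → Set) (D? : ∀ t → Dec (D t))
    where

    Centre : Vec V n → Set
    Centre x = ∃ λ t → D t × x ≡ t ^^ n

    Touched : Vec V n → Vec V n → Set
    Touched x y = Centre x ⊎ Centre y

    touched? : ∀ x y → Dec (Touched x y)
    touched? x y = centre? x ⊎-dec centre? y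
      where
      centre? : ∀ x → Dec (Centre x)
      centre? x = any-finite? (finite G) λ t → D? t ×-dec (x ≟ᵛ t ^^ n)

    rcol : Vec V n → Vec V n → Fin k
    rcol x y with touched? x y
    ... | yes _ = κ
    ... | no  _ = col c x y

    rcol-touched : ∀ {x y} → Touched x y → rcol x y ≡ κ
    rcol-touched {x} {y} t with touched? x y
    ... | yes _ = refl
    ... | no ¬t = ⊥-elim (¬t t)

    rcol-untouched : ∀ {x y} → ¬ Touched x y → rcol x y ≡ col c x y
    rcol-untouched {x} {y} ¬t with touched? x y
    ... | yes t = ⊥-elim (¬t t)
    ... | no _  = refl

    touched-sym : ∀ {x y} → Touched x y → Touched y x
    touched-sym (inj₁ p) = inj₂ p
    touched-sym (inj₂ p) = inj₁ p

    rsym : ∀ {x y} → E x y → rcol x y ≡ rcol y x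
    rsym {x} {y} e with touched? x y
    ... | yes t = sym (rcol-touched (touched-sym t))
    ... | no ¬t = trans (col-sym c e) (sym (rcol-untouched (¬t ∘ touched-sym)))

    -- One of `x` and `y` is a centre, and `z` is within distance two of it.
    after-touched : ∀ {x y z u} → Touched x y → E x y → E y z → E z u → col c z u ≢ κ
    after-touched (inj₁ (t , _ , refl)) e₁ e₂ e₃ = far t _ _ (inj₂ (_ , e₁ , inj₂ (_ , e₂ , refl))) e₃
    after-touched (inj₂ (t , _ , refl)) e₁ e₂ e₃ = far t _ _ (inj₂ (_ , e₂ , inj₁ refl)) e₃

    both-touched : ∀ {x y z u} → Touched x y → Touched z u →
                   E x y → E y z → E z u → x ≢ z → u ≢ y → ⊥
    both-touched (inj₁ (t , _ , refl)) (inj₁ (s , _ , refl)) e₁ e₂ e₃ x≢z u≢y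
      with refl ← sep t s (inj₂ (_ , e₁ , inj₂ (_ , e₂ , inj₁ refl))) = x≢z refl
    -- The extreme vertices `x` and `u` are within distance three, so they coincide and the path
    -- closes up to a triangle.
    both-touched (inj₁ (t , _ , refl)) (inj₂ (s , _ , refl)) e₁ e₂ e₃ x≢z u≢y
      with refl ← sep t s (inj₂ (_ , e₁ , inj₂ (_ , e₂ , inj₂ (_ , e₃ , refl)))) =
      E-triangle-free tf e₁ e₂ e₃
    both-touched (inj₂ (t , _ , refl)) (inj₁ (s , _ , refl)) e₁ e₂ e₃ x≢z u≢y
      with refl ← sep t s (inj₂ (_ , e₂ , inj₁ refl)) = E-irrefl e₂
    both-touched (inj₂ (t , _ , refl)) (inj₂ (s , _ , refl)) e₁ e₂ e₃ x≢z u≢y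
      with refl ← sep t s (inj₂ (_ , e₂ , inj₂ (_ , e₃ , inj₁ refl))) = u≢y refl

    rinj : ∀ {x y z u} → E x y → E y z → E z u → x ≢ z → u ≢ y → rcol x y ≢ rcol z u
    rinj {x} {y} {z} {u} e₁ e₂ e₃ x≢z u≢y eq with touched? x y | touched? z u
    ... | yes p | yes q = both-touched p q e₁ e₂ e₃ x≢z u≢y
    ... | yes p | no _  = after-touched p e₁ e₂ e₃ (sym eq)
    ... | no _  | yes q = after-touched (touched-sym q) (E-sym e₃) (E-sym e₂) (E-sym e₁)
                            (trans (sym (col-sym c e₁)) eq)
    ... | no _  | no _  = inj c e₁ e₂ e₃ x≢z u≢y eq

    recolour : Col n k
    recolour = record { col = rcol ; col-sym = rsym ; inj = rinj }

    P-centre : ∀ {v a} → D v → P recolour v a → a ≡ κ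
    P-centre {v} d (y , e , eq) = trans (sym eq) (rcol-touched (inj₁ (v , d , refl)))

    -- A recoloured edge has an end at another extreme vertex, more than three steps away.
    far-non-centre : ∀ {v} → ¬ D v → Far recolour κ v
    far-non-centre {v} ¬d z u w e eq with touched? z u
    ... | yes (inj₁ (s , d , refl)) with refl ← sep v s (W-suc 2 w) = ¬d d
    ... | yes (inj₂ (s , d , refl)) with refl ← sep v s (W-snoc 2 w e) = ¬d d
    far-non-centre {v} ¬d z u w e eq | no _ = far v z u w e eq

    P-non-centre : ∀ {v} → ¬ D v → ¬ P recolour v κ
    P-non-centre ¬d (y , e , eq) = far-non-centre ¬d _ y (inj₁ refl) e eq

    Q-recolour : ∀ {v} → ¬ Q recolour v κ
    Q-recolour {v} (y , z , e , e′ , z≢ , eq) with touched? y z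
    ... | yes (inj₁ (s , _ , refl)) with refl ← sep v s (inj₂ (_ , e , inj₁ refl)) = E-irrefl e
    ... | yes (inj₂ (s , _ , refl)) with refl ← sep v s (inj₂ (_ , e , inj₂ (_ , e′ , inj₁ refl))) = z≢ refl
    Q-recolour {v} (y , z , e , e′ , z≢ , eq) | no _ = far v y z (inj₂ (_ , e , inj₁ refl)) e′ eq

  -- Extension by a colour far from the extreme vertices.

  private
    index : V → Fin (order G)
    index = Inverse.to (finite G)

    index-injective : ∀ {v t} → index v ≡ index t → v ≡ t
    index-injective {v} {t} eq = trans (sym (strictlyInverseʳ v)) (trans (cong from eq) (strictlyInverseʳ t))
      where open Inverse (finite G) using (from; strictlyInverseʳ)

  -- The edge joining the copies of v and t, where v comes before t, gets the
  -- colour κ together with the star of its endpoint in the copy of v.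
  far-extend : TriangleFree G → ∀ {n k} → Separated n 3 → (κ : Fin k) →
               (Σ (Col n k) λ c → ∀ v → Far c κ v) →
               Σ (Col (suc n) k) λ c → ∀ v → Far c κ v
  far-extend tf {n} {k} sep κ (c , far) = glue , far-glue
    where
    D : V → V → Set
    D v t = Adj G v t × index v Fin.< index t

    D-asym : ∀ {v t} → D v t → ¬ D t v
    D-asym (_ , p) (_ , q) = ℕₚ.<-asym p q

    D-total : ∀ {v t} → Adj G v t → D v t ⊎ D t v
    D-total {v} {t} a with index v Finₚ.<? index t
    ... | yes p = inj₁ (a , p)
    ... | no ¬p = inj₂ (Adj-sym G a , ℕₚ.≤∧≢⇒< (ℕₚ.≮⇒≥ ¬p)
                    (λ eq → adj⇒≢ a (index-injective (sym (Finₚ.toℕ-injective eq)))))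

    module R (v : V) = Recolour tf sep c κ far (D v)
      (λ t → Adj? G v t ×-dec (index v Finₚ.<? index t))

    -- One of the two stars is entirely `κ`; the other is not recoloured and avoids `κ`.
    P∩P : ∀ {v t} → Adj G v t → ∀ {a} → P (R.recolour v) t a → ¬ P (R.recolour t) v a
    P∩P {v} {t} a p q with D-total a
    ... | inj₁ d with refl ← R.P-centre v d p = R.P-non-centre t (D-asym d) q
    ... | inj₂ d with refl ← R.P-centre t d q = R.P-non-centre v (D-asym d) p

    open Glue (separated-weaken (separated-weaken sep)) R.recolour (λ _ _ → κ)
      (λ _ → refl) (λ {v} _ → R.Q-recolour v) P∩P

    far-glue : ∀ v → Far glue κ v
    -- Neither the walk nor the edge `zu` leaves the copy of `v`, as this would put another extreme
    -- vertex within distance two. In its own copy `v` is not a centre.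
    far-glue v (p ∷ z) (q ∷ u) w e eq with W-exit 1 w
    far-glue v (_ ∷ z) (_ ∷ u) w (inj₁ (refl , e)) eq | inj₁ (refl , w′) =
      R.far-non-centre v (irrefl G v ∘ proj₁) z u w′ e (trans (sym (gcol-inside v z u)) eq)
    far-glue v (_ ∷ z) (q ∷ u) w (inj₂ (a , refl , _)) eq | inj₁ (refl , w′) =
      adj⇒≢ a (sep v q (W-suc 2 w′))
    ... | inj₂ (s , a , w′) = adj⇒≢ a (sep v s (W-suc 2 (W-suc 1 w′)))

  far-extend* : TriangleFree G → ∀ {k} (κ : Fin k) →
                (Σ (Col 3 k) λ c → ∀ v → Far c κ v) →
                ∀ m → Σ (Col (3 + m) k) λ c → ∀ v → Far c κ v
  far-extend* tf κ c zero    = c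
  far-extend* tf κ c (suc m) =
    far-extend tf (separated-weaken (separated₃ m)) κ (far-extend* tf κ c m)

  -- Leaves, fits and hubs.

  edge₁ : ∀ {v t} → E (v ∷ []) (t ∷ []) → Adj G v t
  edge₁ (inj₂ (a , _)) = a

  extreme-edge : ∀ {n v t} {y : Vec V (suc n)} → E (v ^^ (2 + n)) (t ∷ y) →
                 t ≡ v × E (v ^^ suc n) y
  extreme-edge (inj₁ (eq , e))    = sym eq , e
  extreme-edge (inj₂ (a , p , _)) = ⊥-elim (adj⇒≢ a (∷-injectiveˡ p))

  -- The conditions of `Glue` for a bridging edge of colour `f` between the copy of `u`, coloured by
  -- `recode θ d`, and the copy of `w`, coloured by `c`.
  Fit : ∀ {n k} → Col n k → Col n k → Injection {k} → Fin k → V → V → Set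
  Fit c d (θ , _) f u w =
    ¬ Q c u f ×
    (∀ {b} → Q d w b → θ b ≢ f) ×
    (∀ {a b} → P c u a → P d w b → θ b ≢ a)

  Leaf : V → V → Set
  Leaf w u = Adj G w u × (∀ t → Adj G u t → t ≡ w)

  not-own-leaf : ∀ {w} → ¬ Leaf w w
  not-own-leaf (a , _) = irrefl G _ a

  Leaf? : ∀ w u → Dec (Leaf w u)
  Leaf? w u = Adj? G w u ×-dec all-finite? (finite G) (λ t → Adj? G u t →-dec t ≟ w)

  P? : ∀ {n k} (c : Col n k) v a → Dec (P c v a)
  P? {n} c v a = any-finite? (Vec-finite (finite G) n) λ y → E? _ y ×-dec (_ Finₚ.≟ a)

  Q? : ∀ {n k} (c : Col n k) v a → Dec (Q c v a)
  Q? {n} c v a = any-finite? (Vec-finite (finite G) n) λ y →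
    any-finite? (Vec-finite (finite G) n) λ z →
      E? _ y ×-dec E? y z ×-dec ¬? (z ≟ᵛ _) ×-dec (_ Finₚ.≟ a)

  -- A replacement for the colouring of the copy of `w`: it adds no colour near the extreme vertices
  -- of other than leaves at `w`, and, recoded, it also serves for the copy of each such leaf.
  record Hub {k} (c : Col 2 k) (w : V) : Set where
    field
      hub    : Col 2 k
      P-hub  : ∀ {u} → ¬ Leaf w u → ∀ {a} → P hub u a → P c u a
      Q-hub  : ∀ {u} → ¬ Leaf w u → ∀ {a} → Q hub u a → Q c u a
      θ-leaf : ∀ {u} → Leaf w u → Injection {k}
      f-leaf : ∀ {u} → Leaf w u → Fin k
      fits   : ∀ {u} (l : Leaf w u) → Fit hub hub (θ-leaf l) (f-leaf l) u w

  -- Existence of hubs.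

  module _ {k} (c : Col 2 k) (κ : Fin k) (w : V)
    (κ∉P : ¬ P c w κ) (κ∉Q : ¬ Q c w κ)
    where

    private
      h : V → Fin k
      h t = col c (w ∷ w ∷ []) (w ∷ t ∷ [])

    -- At a leaf only one colour `a′` occurs, so the recoding has to keep `f` out of the image of
    -- `Q c w` and `a′` out of that of `P c w`. It sends `y` to `f` and `y′` to `a′` if these
    -- differ; if they agree, it sends `κ` there.
    leaf-hub : ∀ {y y′} → y ≢ y′ → ¬ Q c w y → ¬ P c w y′ →
               (∀ {u} → Leaf w u → ∃ λ f → ¬ Q c u f) → Hub c w
    leaf-hub {y} {y′} y≢y′ y∉Q y′∉P free = record
      { hub = c ; P-hub = λ _ → id ; Q-hub = λ _ → id
      ; θ-leaf = proj₁ ∘ choice ; f-leaf = proj₁ ∘ proj₂ ∘ choice ; fits = proj₂ ∘ proj₂ ∘ choice }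
      where
      choice : ∀ {u} → Leaf w u → Σ Injection λ θ → Σ (Fin k) λ f → Fit c c θ f u w
      choice {u} l with free l
      ... | f , f∉Q = main
        where
        a′ : Fin k
        a′ = col c (u ∷ u ∷ []) (u ∷ w ∷ [])

        only : ∀ {a} → P c u a → a′ ≡ a
        only (_ ∷ t ∷ [] , e , eq) with refl , e′ ← extreme-edge e
          with refl ← proj₂ l t (edge₁ e′) = eq

        main : Σ Injection λ θ → Σ (Fin k) λ f → Fit c c θ f u w
        main with f Finₚ.≟ a′
        ... | yes refl = (transpose κ a′ , transpose-injective κ a′) , a′ , f∉Q ,
              (λ q eq → κ∉Q (subst (Q c w) (back eq) q)) ,
              (λ p q eq → κ∉P (subst (P c w) (back (trans eq (sym (only p)))) q))
          where
          back : ∀ {b} → transpose κ a′ b ≡ a′ → b ≡ κ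
          back eq = transpose-injective κ a′ (trans eq (sym (transpose-left κ a′)))
        ... | no f≢a′ with θ , θy , θy′ ← send-two y≢y′ f≢a′ = θ , f , f∉Q ,
              (λ q eq → y∉Q (subst (Q c w) (proj₂ θ (trans eq (sym θy))) q)) ,
              (λ p q eq → y′∉P (subst (P c w) (proj₂ θ (trans eq (trans (sym (only p)) (sym θy′)))) q))

    -- If all colours but κ occur both at and next to the extreme vertex of w,
    -- then they occur once each: h is injective, and the other edges at
    -- (w , t) have colour h t.
    module Saturated (fullP : ∀ a → a ≢ κ → P c w a) (fullQ : ∀ a → a ≢ κ → Q c w a) where

      spoke : ∀ {t} → Adj G w t → E (w ∷ w ∷ []) (w ∷ t ∷ [])
      spoke a = inj₁ (refl , inj₂ (a , refl , refl))

      h≢κ : ∀ {t} → Adj G w t → h t ≢ κ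
      h≢κ a eq = κ∉P (_ , spoke a , eq)

      tip-≢ : ∀ {s t z} → Adj G w s → Adj G w t → s ≢ t → E (w ∷ t ∷ []) z → z ≢ w ∷ w ∷ [] →
              h s ≢ col c (w ∷ t ∷ []) z
      tip-≢ a b s≢t e z≢ eq =
        inj c (E-sym (spoke a)) (spoke b) e (λ { refl → s≢t refl }) z≢
          (trans (sym (col-sym c (spoke a))) eq)

      -- The colour is not `κ`, so by `fullP` it is some `h s`; for `s ≢ t` the spoke towards `t`
      -- would join two edges of equal colour.
      tip : ∀ {t z} → Adj G w t → E (w ∷ t ∷ []) z → z ≢ w ∷ w ∷ [] →
            col c (w ∷ t ∷ []) z ≡ h t
      tip {t} {z} a e z≢ with fullP _ (λ eq → κ∉Q (_ , z , spoke a , e , z≢ , eq))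
      ... | _ ∷ s ∷ [] , e′ , eq with refl , e″ ← extreme-edge e′ with s ≟ t
      ...   | yes refl = sym eq
      ...   | no s≢t   = ⊥-elim (tip-≢ (edge₁ e″) a s≢t e z≢ eq)

      -- By `fullQ` the colour occurs beyond the end of some spoke, and then no other spoke can have
      -- it.
      h-injective : ∀ {s t} → Adj G w s → Adj G w t → h s ≡ h t → s ≡ t
      h-injective {s} {t} a b hs≡ht with fullQ _ (h≢κ a)
      ... | _ ∷ r ∷ [] , z , e , e′ , z≢ , eq with refl , e″ ← extreme-edge e =
        trans (to-r a refl) (sym (to-r b (sym hs≡ht)))
        where
        to-r : ∀ {t} → Adj G w t → h t ≡ h s → t ≡ r
        to-r {t} b ht≡hs with t ≟ r
        ... | yes t≡r = t≡r
        ... | no t≢r  = ⊥-elim (tip-≢ b (edge₁ e″) t≢r e′ z≢ (trans ht≡hs (sym eq)))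

      σ : V → Fin k → Fin k
      σ u = transpose (h u) κ

      σ-hit : ∀ {u a} → σ u a ≡ h u → a ≡ κ
      σ-hit {u} eq = transpose-injective (h u) κ (trans eq (sym (transpose-right (h u) κ)))

      -- Each leaf `v` at `w` has its copy of `G` coloured like that of `w` with `h v` and `κ`
      -- exchanged. This puts `κ` on the only edge at the extreme vertex of `v`.
      dcol : Vec V 2 → Vec V 2 → Fin k
      dcol (v ∷ x) (t ∷ y) with v ≟ t ×-dec Leaf? w v
      ... | yes _ = σ v (col c (w ∷ x) (w ∷ y))
      ... | no  _ = col c (v ∷ x) (t ∷ y)

      dcol-leaf : ∀ {v} x y → Leaf w v → dcol (v ∷ x) (v ∷ y) ≡ σ v (col c (w ∷ x) (w ∷ y))
      dcol-leaf {v} x y l with v ≟ v ×-dec Leaf? w v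
      ... | yes _ = refl
      ... | no ¬p = ⊥-elim (¬p (refl , l))

      dcol-other : ∀ {v t} x y → ¬ (v ≡ t × Leaf w v) → dcol (v ∷ x) (t ∷ y) ≡ col c (v ∷ x) (t ∷ y)
      dcol-other {v} {t} x y ¬p with v ≟ t ×-dec Leaf? w v
      ... | yes p = ⊥-elim (¬p p)
      ... | no  _ = refl

      dcol-cross : ∀ {v t} x y → Adj G v t → dcol (v ∷ x) (t ∷ y) ≡ col c (v ∷ x) (t ∷ y)
      dcol-cross x y a = dcol-other x y (adj⇒≢ a ∘ proj₁)

      dsym : ∀ {x y} → E x y → dcol x y ≡ dcol y x
      dsym {v ∷ x} {t ∷ y} e@(inj₂ (a , _)) =
        trans (dcol-cross x y a) (trans (col-sym c {v ∷ x} {t ∷ y} e) (sym (dcol-cross y x (Adj-sym G a))))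
      dsym {v ∷ x} {_ ∷ y} (inj₁ (refl , e)) = inside (Leaf? w v)
        where
        inside : Dec (Leaf w v) → dcol (v ∷ x) (v ∷ y) ≡ dcol (v ∷ y) (v ∷ x)
        inside (yes l) = trans (dcol-leaf x y l)
          (trans (cong (σ v) (col-sym c (inj₁ (refl , e)))) (sym (dcol-leaf y x l)))
        inside (no ¬l) = trans (dcol-other x y (¬l ∘ proj₂))
          (trans (col-sym c {v ∷ x} {v ∷ y} (inj₁ (refl , e))) (sym (dcol-other y x (¬l ∘ proj₂))))

      bridge : ∀ {u} → Leaf w u → col c (u ∷ w ∷ []) (w ∷ u ∷ []) ≡ h u
      bridge (a , _) = trans (col-sym c e) (tip a (E-sym e) λ eq → adj⇒≢ a (sym (∷-injectiveˡ eq)))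
        where
        e = inj₂ (Adj-sym G a , refl , refl)

      -- Outside the copy of `v` the last edge can only be one of two, both of colour `h v`. The
      -- first edge then has colour `σ v (h t)` for some neighbour `t` of `w`, and this is `h v`
      -- only if `h t` is `κ`.
      leaf-copy-inj : ∀ {v x y z u} → Leaf w v → E x y → E (v ∷ y) z → E z u →
                      v ∷ x ≢ z → u ≢ v ∷ y → dcol (v ∷ x) (v ∷ y) ≢ dcol z u
      leaf-copy-inj {v} {x} {y} {_ ∷ z} {_ ∷ u} l e₁ (inj₁ (refl , e₂)) (inj₁ (refl , e₃)) x≢z u≢y eq =
        inj c (inj₁ (refl , e₁)) (inj₁ (refl , e₂)) (inj₁ (refl , e₃))
          (x≢z ∘ cong (v ∷_) ∘ ∷-injectiveʳ) (u≢y ∘ cong (v ∷_) ∘ ∷-injectiveʳ)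
          (transpose-injective (h v) κ
            (trans (sym (dcol-leaf x y l)) (trans eq (dcol-leaf z u l))))
      leaf-copy-inj {v} {x} {b ∷ []} {_ ∷ z} {q ∷ u} l e₁ (inj₁ (refl , e₂)) (inj₂ (a , refl , refl)) x≢z u≢y eq
        with refl ← proj₂ l q a = h≢κ b~w (σ-hit {v} (trans (cong (σ v) (sym colour-x)) eq′))
        where
        b~w : Adj G w b
        b~w = Adj-sym G (edge₁ e₂)

        colour-x : col c (w ∷ x) (w ∷ b ∷ []) ≡ h b
        colour-x = trans (col-sym c (inj₁ (refl , e₁)))
          (tip b~w (inj₁ (refl , E-sym e₁)) (x≢z ∘ cong (v ∷_) ∘ ∷-injectiveʳ))

        eq′ : σ v (col c (w ∷ x) (w ∷ b ∷ [])) ≡ h v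
        eq′ = trans (sym (dcol-leaf x _ l)) (trans eq (trans (dcol-cross _ _ a) (bridge l)))
      leaf-copy-inj {v} {a ∷ []} {_} {p ∷ z} {_ ∷ g ∷ []} l e₁ (inj₂ (b , refl , refl)) (inj₁ (refl , e₃)) x≢z u≢y eq
        with refl ← proj₂ l p b | refl ← proj₂ l g (edge₁ e₃) =
        h≢κ (Adj-sym G (edge₁ e₁)) (σ-hit {v} (trans (cong (σ v) (col-sym c (spoke (Adj-sym G (edge₁ e₁)))))
          (trans (sym (dcol-leaf _ _ l)) (trans eq
            (trans (dcol-other _ _ (not-own-leaf ∘ proj₂)) (sym (col-sym c (spoke (proj₁ l)))))))))
      leaf-copy-inj {v} {x} {_} {p ∷ z} {q ∷ u} l e₁ (inj₂ (b , refl , refl)) (inj₂ (_ , v≡q , refl)) x≢z u≢y eq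
        with refl ← ∷-injectiveˡ v≡q = u≢y refl

      Changed : Vec V 2 → Vec V 2 → Set
      Changed (v ∷ _) (t ∷ _) = v ≡ t × Leaf w v

      changed? : ∀ x y → Dec (Changed x y)
      changed? (v ∷ _) (t ∷ _) = v ≟ t ×-dec Leaf? w v

      unchanged : ∀ x y → ¬ Changed x y → dcol x y ≡ col c x y
      unchanged (v ∷ x) (t ∷ y) = dcol-other x y

      changed-inj : ∀ {x y z u} → Changed x y → E x y → E y z → E z u → x ≢ z → u ≢ y →
                    dcol x y ≢ dcol z u
      changed-inj {v ∷ x} {_ ∷ y} (refl , l) (inj₁ (_ , e₁)) = leaf-copy-inj l e₁
      changed-inj {v ∷ x} {_ ∷ y} (refl , l) (inj₂ (a , _))  = ⊥-elim (irrefl G v a)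

      changed-sym : ∀ x y → Changed x y → Changed y x
      changed-sym (_ ∷ _) (_ ∷ _) (refl , l) = refl , l

      dinj : ∀ {x y z u} → E x y → E y z → E z u → x ≢ z → u ≢ y → dcol x y ≢ dcol z u
      dinj {x} {y} {z} {u} e₁ e₂ e₃ x≢z u≢y eq with changed? x y | changed? z u
      ... | yes p | _     = changed-inj p e₁ e₂ e₃ x≢z u≢y eq
      ... | no _  | yes q = changed-inj (changed-sym z u q) (E-sym e₃) (E-sym e₂) (E-sym e₁) u≢y x≢z
                              (trans (sym (dsym e₃)) (trans (sym eq) (dsym e₁)))
      ... | no ¬p | no ¬q = inj c e₁ e₂ e₃ x≢z u≢y
                              (trans (sym (unchanged x y ¬p)) (trans eq (unchanged z u ¬q)))

      -- At a leaf `κ` is now the only colour and does not recur one step beyond, while near `w` it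
      -- is absent; so `f = κ` fits without recoding.
      saturated-hub : Hub c w
      saturated-hub = record
        { hub = d ; P-hub = P-d ; Q-hub = Q-d
        ; θ-leaf = λ _ → id , id ; f-leaf = λ _ → κ
        ; fits = λ l → Q-leaf l
            , (λ { q refl → κ∉Q (Q-d not-own-leaf q) })
            , (λ { p q refl → κ∉P (subst (P c w) (P-leaf l p) (P-d not-own-leaf q)) }) }
        where
        d : Col 2 k
        d = record { col = dcol ; col-sym = dsym ; inj = dinj }

        P-d : ∀ {u} → ¬ Leaf w u → ∀ {a} → P d u a → P c u a
        P-d ¬l (_ ∷ y , e , eq) = _ , e , trans (sym (dcol-other _ y (¬l ∘ proj₂))) eq

        Q-d : ∀ {u} → ¬ Leaf w u → ∀ {a} → Q d u a → Q c u a
        Q-d ¬l (_ ∷ y , _ ∷ z , e , e′ , z≢ , eq) with refl , _ ← extreme-edge e =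
          _ , _ , e , e′ , z≢ , trans (sym (dcol-other y z (¬l ∘ proj₂))) eq

        P-leaf : ∀ {u} → Leaf w u → ∀ {a} → P d u a → a ≡ κ
        P-leaf {u} l (_ ∷ t ∷ [] , e , eq) with refl , e′ ← extreme-edge e
          with refl ← proj₂ l t (edge₁ e′) =
          trans (sym eq) (trans (dcol-leaf _ _ l)
            (trans (cong (σ u) (sym (col-sym c (spoke (proj₁ l))))) (transpose-left (h u) κ)))

        Q-leaf : ∀ {u} → Leaf w u → ¬ Q d u κ
        Q-leaf {u} l (_ ∷ t ∷ [] , _ ∷ z , e , e′ , z≢ , eq) with refl , e″ ← extreme-edge e
          with refl ← proj₂ l t (edge₁ e″) = beyond z e′ z≢ eq
          where
          beyond : ∀ {p} z → E (u ∷ w ∷ []) (p ∷ z) → p ∷ z ≢ u ∷ u ∷ [] →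
                   dcol (u ∷ w ∷ []) (p ∷ z) ≢ κ
          beyond (s ∷ []) (inj₁ (refl , e)) z≢ eq =
            z≢ (cong (λ s → u ∷ s ∷ []) (h-injective (edge₁ e) (proj₁ l)
              (transpose-injective (h u) κ (trans (sym (dcol-leaf _ _ l))
                (trans eq (sym (transpose-left (h u) κ)))))))
          beyond {p} z (inj₂ (a , refl , refl)) z≢ eq =
            h≢κ (proj₁ l) (trans (sym (bridge l)) (trans (sym (dcol-cross _ _ a)) eq))

    -- A colour other than `κ` missing at `w` or one step beyond forms with `κ` the pair that
    -- `leaf-hub` asks for.
    any-hub : (∀ {u} → Leaf w u → ∃ λ f → ¬ Q c u f) → Hub c w
    any-hub free with Finₚ.any? (λ a → ¬? (a Finₚ.≟ κ) ×-dec ¬? (P? c w a))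
                    | Finₚ.any? (λ a → ¬? (a Finₚ.≟ κ) ×-dec ¬? (Q? c w a))
    ... | yes (a , a≢κ , a∉P) | _ = leaf-hub (a≢κ ∘ sym) κ∉Q a∉P free
    ... | no _  | yes (a , a≢κ , a∉Q) = leaf-hub a≢κ a∉Q κ∉P free
    ... | no ¬p | no ¬q = Saturated.saturated-hub
            (λ a a≢κ → decidable-stable (P? c w a) (λ a∉P → ¬p (a , a≢κ , a∉P)))
            (λ a a≢κ → decidable-stable (Q? c w a) (λ a∉Q → ¬q (a , a≢κ , a∉Q)))

  -- Restriction to copies, and fits after recoding.

  P-restrict : ∀ {n k} (c : Col (suc n) k) {v a} → P (restrict c v) v a → P c v a
  P-restrict c (y , e , eq) = _ , inj₁ (refl , e) , eq

  Q-restrict : ∀ {n k} (c : Col (suc n) k) {v a} → Q (restrict c v) v a → Q c v a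
  Q-restrict c (y , z , e , e′ , z≢ , eq) =
    _ , _ , inj₁ (refl , e) , inj₁ (refl , e′) , z≢ ∘ ∷-injectiveʳ , eq

  module _ {n k} (c : Col (suc n) k) {v t} (a : Adj G v t) where

    private
      across : E (v ∷ t ^^ n) (t ∷ v ^^ n)
      across = inj₂ (a , refl , refl)

      v≢t : ∀ {x y : Vec V n} → v ∷ x ≢ t ∷ y
      v≢t = adj⇒≢ a ∘ ∷-injectiveˡ

    -- The conditions of `Glue` are also necessary: every colouring meets them at its bridging
    -- edges.
    crossing∉Q : ¬ Q (restrict c v) t (col c (v ∷ t ^^ n) (t ∷ v ^^ n))
    crossing∉Q (y , z , e , e′ , z≢ , eq) =
      inj c (E-sym across) (inj₁ (refl , e)) (inj₁ (refl , e′)) (v≢t ∘ sym) (z≢ ∘ ∷-injectiveʳ)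
        (trans (sym (col-sym c across)) (sym eq))

    crossing-P∩P : ∀ {b} → P (restrict c v) t b → ¬ P (restrict c t) v b
    crossing-P∩P (y , e , eq) (y′ , e′ , eq′) =
      inj c (inj₁ (refl , E-sym e)) across (inj₁ (refl , e′)) v≢t (v≢t ∘ sym)
        (trans (sym (col-sym c (inj₁ (refl , e)))) (trans eq (sym eq′)))

  -- After gluing, the colours near `u` are images under `θ` and those near `w` are old ones;
  -- applying `θ` to both sides of the old conditions gives the new ones.
  fit-recode : ∀ {n k} {c d : Col n k} {θ : Injection} {f u w} → Fit c d θ f u w →
    ∀ {m} {c′ d′ : Col m k} →
    (∀ {a} → P c′ u a → P (recode (proj₁ θ) (proj₂ θ) c) u a) →
    (∀ {a} → Q c′ u a → Q (recode (proj₁ θ) (proj₂ θ) c) u a) →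
    (∀ {a} → P d′ w a → P d w a) → (∀ {a} → Q d′ w a → Q d w a) →
    Fit c′ d′ (proj₁ θ ∘ proj₁ θ , proj₂ θ ∘ proj₂ θ) (proj₁ θ f) u w
  fit-recode {θ = θ , θ-inj} {u = u} {w} (f∉Q , θQ , θP) {c′ = c′} {d′} Pu Qu Pw Qw =
      f∉Q′
    , (λ q eq → θQ (Qw q) (θ-inj eq))
    , θP′
    where
    f∉Q′ : ¬ Q c′ u (θ _)
    f∉Q′ q with y , z , e , e′ , z≢ , eq ← Qu q = f∉Q (y , z , e , e′ , z≢ , θ-inj eq)

    θP′ : ∀ {a b} → P c′ u a → P d′ w b → θ (θ b) ≢ a
    θP′ p q eq with y , e , eq′ ← Pu p = θP (y , e , refl) (Pw q) (θ-inj (trans eq (sym eq′)))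

  -- Gluing and extension over a bipartition.

  module Bipartite (B : Bipartition G) where
    open Bipartition B renaming (A to InA ; B to InB)

    A⇒B : ∀ {u w} → InA u → Adj G u w → InB w
    A⇒B {u} {w} α a with cover w
    ... | inj₁ α′ = ⊥-elim (A-independent u w α α′ a)
    ... | inj₂ β  = β

    B⇒A : ∀ {w u} → InB w → Adj G w u → InA u
    B⇒A {w} {u} β a with cover u
    ... | inj₁ α  = α
    ... | inj₂ β′ = ⊥-elim (B-independent w u β β′ a)

    pick : {X : Set} → V → X → X → X
    pick v x y with cover v
    ... | inj₁ _ = x
    ... | inj₂ _ = y

    pick-A : {X : Set} {v : V} {x y : X} → InA v → pick v x y ≡ x
    pick-A {v = v} α with cover v
    ... | inj₁ _ = refl
    ... | inj₂ β = ⊥-elim (disjoint v α β)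

    pick-B : {X : Set} {v : V} {x y : X} → InB v → pick v x y ≡ y
    pick-B {v = v} β with cover v
    ... | inj₁ α = ⊥-elim (disjoint v α β)
    ... | inj₂ _ = refl

    module GlueAB {n k} (sep : Separated n 1) (CA CB : V → Col n k) (F : V → V → Fin k)
      (F∉QA : ∀ {u w} → InA u → Adj G u w → ¬ Q (CA u) w (F u w))
      (F∉QB : ∀ {u w} → InA u → Adj G u w → ¬ Q (CB w) u (F u w))
      (PA∩PB : ∀ {u w} → InA u → Adj G u w → ∀ {a} → P (CA u) w a → ¬ P (CB w) u a)
      where

      C : V → Col n k
      C v = pick v (CA v) (CB v)

      F′ : V → V → Fin k
      F′ v t = pick v (F v t) (F t v)

      F′-sym : ∀ {v t} → Adj G v t → F′ v t ≡ F′ t v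
      F′-sym {v} {t} a with cover v
      ... | inj₁ α = sym (pick-B (A⇒B α a))
      ... | inj₂ β = sym (pick-A (B⇒A β a))

      F′∉Q : ∀ {v t} → Adj G v t → ¬ Q (C v) t (F′ v t)
      F′∉Q {v} {t} a with cover v
      ... | inj₁ α = F∉QA α a
      ... | inj₂ β = F∉QB (B⇒A β a) (Adj-sym G a)

      P∩P : ∀ {v t} → Adj G v t → ∀ {b} → P (C v) t b → ¬ P (C t) v b
      P∩P {v} {t} a {b} with cover v
      ... | inj₁ α = λ p q → PA∩PB α a p (subst (λ c → P c v b) (pick-B (A⇒B α a)) q)
      ... | inj₂ β = λ p q → PA∩PB (B⇒A β a) (Adj-sym G a)
                               (subst (λ c → P c v b) (pick-A (B⇒A β a)) q) p

      open Glue sep C F′ F′-sym F′∉Q P∩P public using (glue)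
      open Glue sep C F′ F′-sym F′∉Q P∩P using (P-glue; Q-glue)

      P-glue-A : ∀ {u} → InA u → ∀ {a} → P glue u a → P (CA u) u a
      P-glue-A α {a} p = subst (λ c → P c _ a) (pick-A α) (P-glue p)

      P-glue-B : ∀ {w} → InB w → ∀ {a} → P glue w a → P (CB w) w a
      P-glue-B β {a} p = subst (λ c → P c _ a) (pick-B β) (P-glue p)

      Q-glue-A : ∀ {u} → InA u → ∀ {a} → Q glue u a → Q (CA u) u a
      Q-glue-A α {a} q = subst (λ c → Q c _ a) (pick-A α) (Q-glue q)

      Q-glue-B : ∀ {w} → InB w → ∀ {a} → Q glue w a → Q (CB w) w a
      Q-glue-B β {a} q = subst (λ c → Q c _ a) (pick-B β) (Q-glue q)

    -- The copy of u ∈ A may be recoded by θ and joined to its neighbours by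
    -- edges of colour f.
    Extensible : ∀ {n k} → Col n k → Set
    Extensible {k = k} c = ∀ u → Σ (Injection {k}) λ θ → Σ (Fin k) λ f →
      InA u → ∀ {w} → Adj G u w → Fit c c θ f u w

    extend-bipartite : ∀ {n k} → Separated n 1 →
      (Σ (Col n k) λ c → Extensible c) → Σ (Col (suc n) k) λ c → Extensible c
    extend-bipartite {n} {k} sep (c , ext) = glue , λ u →
        (proj₁ (θ u) ∘ proj₁ (θ u) , proj₂ (θ u) ∘ proj₂ (θ u))
      , proj₁ (θ u) (f u)
      , λ α a → fit-recode {c = c} {c} {θ u} (fits α a) {c′ = glue} {glue}
          (P-glue-A α) (Q-glue-A α) (P-glue-B (A⇒B α a)) (Q-glue-B (A⇒B α a))
      where
      θ : V → Injection {k}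
      θ = proj₁ ∘ ext

      f : V → Fin k
      f = proj₁ ∘ proj₂ ∘ ext

      fits : ∀ {u} → InA u → ∀ {w} → Adj G u w → Fit c c (θ u) (f u) u w
      fits {u} = proj₂ (proj₂ (ext u))

      open GlueAB sep (λ u → recode (proj₁ (θ u)) (proj₂ (θ u)) c) (λ _ → c) (λ u _ → f u)
        (λ α a (y , z , e , e′ , z≢ , eq) → proj₁ (proj₂ (fits α a)) (y , z , e , e′ , z≢ , refl) eq)
        (λ α a → proj₁ (fits α a))
        (λ α a (y , e , eq) q → proj₂ (proj₂ (fits α a)) q (y , e , refl) eq)

    extend-bipartite* : ∀ {k} → (Σ (Col 3 k) λ c → Extensible c) →
                        ∀ m → Σ (Col (3 + m) k) λ c → Extensible c
    extend-bipartite* c zero    = c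
    extend-bipartite* c (suc m) =
      extend-bipartite (separated-weaken (separated-weaken (separated-weaken (separated₃ m))))
        (extend-bipartite* c m)

    -- The extensible colouring of level three.

    module Base {k} (c : Col 3 k) (κ : Fin k)
      (starA : ∀ {u} → InA u → ∀ {a} → P c u a → a ≡ κ)
      (κ∉PB : ∀ {w} → InB w → ¬ P c w κ)
      (κ∉QB : ∀ {w} → InB w → ¬ Q c w κ)
      where

      -- The edge from the extreme vertex towards a second neighbour `s` has colour `κ` and
      -- conflicts with every edge beyond the neighbour towards `t`.
      κ∉Q-nonleaf : ∀ {u} → InA u → (∀ w → ¬ Leaf w u) → ¬ Q c u κ
      κ∉Q-nonleaf {u} α nonleaf (_ ∷ _ ∷ t ∷ [] , z , e , e′ , z≢ , eq)
        with refl , e₁ ← extreme-edge e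
        with refl , e₂ ← extreme-edge e₁
        with any-finite? (finite G) (λ s → Adj? G u s ×-dec ¬? (s ≟ t))
      ... | no none = nonleaf t (Adj-sym G (edge₁ e₂) ,
              λ s a → decidable-stable (s ≟ t) (λ s≢t → none (s , a , s≢t)))
      ... | yes (s , a , s≢t) = inj c (E-sym es) e e′ (λ { refl → s≢t refl }) z≢
              (trans (sym (col-sym c es)) (trans (starA α (_ , es , refl)) (sym eq)))
        where
        es : E (u ^^ 3) (u ∷ u ∷ s ∷ [])
        es = inj₁ (refl , inj₁ (refl , inj₂ (a , refl , refl)))

      -- The equation lets `d` be a function on all vertices, with a placeholder value on `A`.
      hubs : ∀ w → Σ (Col 2 k) λ d → InB w → Σ (Hub (restrict c w) w) λ H → Hub.hub H ≡ d
      hubs w with cover w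
      ... | inj₁ α = restrict c w , λ β → ⊥-elim (disjoint w α β)
      ... | inj₂ β = Hub.hub H , λ _ → H , refl
        where
        H : Hub (restrict c w) w
        H = any-hub (restrict c w) κ w (κ∉PB β ∘ P-restrict c) (κ∉QB β ∘ Q-restrict c)
              (λ l → _ , crossing∉Q c (proj₁ l))

      d : V → Col 2 k
      d = proj₁ ∘ hubs

      P-d : ∀ {w u} → InB w → ¬ Leaf w u → ∀ {a} → P (d w) u a → P (restrict c w) u a
      P-d {w} β ¬l {a} p with H , eq ← proj₂ (hubs w) β =
        Hub.P-hub H ¬l (subst (λ d → P d _ a) (sym eq) p)

      Q-d : ∀ {w u} → InB w → ¬ Leaf w u → ∀ {a} → Q (d w) u a → Q (restrict c w) u a
      Q-d {w} β ¬l {a} q with H , eq ← proj₂ (hubs w) β =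
        Hub.Q-hub H ¬l (subst (λ d → Q d _ a) (sym eq) q)

      fit-d : ∀ {w u} → InB w → Leaf w u →
              Σ (Injection {k}) λ θ → Σ (Fin k) λ f → Fit (d w) (d w) θ f u w
      fit-d {w} {u} β l with H , eq ← proj₂ (hubs w) β =
        Hub.θ-leaf H l , Hub.f-leaf H l ,
        subst (λ d → Fit d d (Hub.θ-leaf H l) (Hub.f-leaf H l) u w) eq (Hub.fits H l)

      -- `copy` and `F` serve the gluing at level three, `θ` and `f` the next one. `fit` ranges over
      -- all `c′` and `d′` with no further colours near `u` and `w`, so that it applies to the glued
      -- colouring.
      record Copy (u : V) : Set where
        field
          copy    : Col 2 k
          F       : V → Fin k
          θ       : Injection {k}
          f       : Fin k
          F∉Q     : InA u → ∀ {w} → Adj G u w → ¬ Q copy w (F w)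
          F∉Q-d   : InA u → ∀ {w} → Adj G u w → ¬ Q (d w) u (F w)
          P∩P     : InA u → ∀ {w} → Adj G u w → ∀ {a} → P copy w a → ¬ P (d w) u a
          fit     : InA u → ∀ {w} → Adj G u w →
                    ∀ {m} {c′ d′ : Col m k} →
                    (∀ {a} → P c′ u a → P copy u a) → (∀ {a} → Q c′ u a → Q copy u a) →
                    (∀ {a} → P d′ w a → P (d w) w a) → (∀ {a} → Q d′ w a → Q (d w) w a) →
                    Fit c′ d′ θ f u w

      copy-B : ∀ {u} → InB u → Copy u
      copy-B {u} β = record
        { copy = restrict c u ; F = λ _ → κ ; θ = id , id ; f = κ
        ; F∉Q = λ α → ⊥-elim (disjoint u α β) ; F∉Q-d = λ α → ⊥-elim (disjoint u α β)
        ; P∩P = λ α → ⊥-elim (disjoint u α β) ; fit = λ α → ⊥-elim (disjoint u α β) }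

      -- The only bridging edge of this copy leads to the copy of `w`, where the recoded hub fits.
      copy-leaf : ∀ {w u} → InA u → Leaf w u → Copy u
      copy-leaf {w} {u} α l with (θ , θ-inj) , f , f∉Q , θQ , θP ← fit-d (A⇒B α (Adj-sym G (proj₁ l))) l = record
        { copy  = recode θ θ-inj (d w) ; F = λ _ → f ; θ = θ ∘ θ , θ-inj ∘ θ-inj ; f = θ f
        ; F∉Q   = λ _ a → F∉Q (proj₂ l _ a)
        ; F∉Q-d = λ _ a q → f∉Q (subst (λ w → Q (d w) u f) (proj₂ l _ a) q)
        ; P∩P   = λ _ a → P∩P (proj₂ l _ a)
        ; fit   = λ _ a {c′ = c′} {d′} → fit (proj₂ l _ a) {c′ = c′} {d′} }
        where
        F∉Q : ∀ {t} → t ≡ w → ¬ Q (recode θ θ-inj (d w)) t f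
        F∉Q refl (y , z , e , e′ , z≢ , eq) = θQ (y , z , e , e′ , z≢ , refl) eq

        P∩P : ∀ {t} → t ≡ w → ∀ {a} → P (recode θ θ-inj (d w)) t a → ¬ P (d t) u a
        P∩P refl (y , e , eq) p = θP p (y , e , refl) eq

        fit : ∀ {t} → t ≡ w → ∀ {m} {c′ d′ : Col m k} →
              (∀ {a} → P c′ u a → P (recode θ θ-inj (d w)) u a) →
              (∀ {a} → Q c′ u a → Q (recode θ θ-inj (d w)) u a) →
              (∀ {a} → P d′ t a → P (d t) t a) → (∀ {a} → Q d′ t a → Q (d t) t a) →
              Fit c′ d′ (θ ∘ θ , θ-inj ∘ θ-inj) (θ f) u t
        fit refl {c′ = c′} {d′} = fit-recode {c = d w} {d w} {θ , θ-inj} (f∉Q , θQ , θP) {c′ = c′} {d′}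

      -- The colours of `c` can stay, as the hubs add none near `u`. At the next level `κ` suits the
      -- bridging edges, being absent one step beyond `u` and near each `w`.
      copy-nonleaf : ∀ {u} → InA u → (∀ w → ¬ Leaf w u) → Copy u
      copy-nonleaf {u} α nonleaf = record
        { copy  = restrict c u ; F = λ w → col c (u ∷ w ^^ 2) (w ∷ u ^^ 2) ; θ = id , id ; f = κ
        ; F∉Q   = λ _ a → crossing∉Q c a
        ; F∉Q-d = λ _ {w} a q → crossing∉Q c (Adj-sym G a)
            (subst (Q (restrict c w) u) (col-sym c (inj₂ (a , refl , refl)))
              (Q-d (A⇒B α a) (nonleaf w) q))
        ; P∩P   = λ _ {w} a p q → crossing-P∩P c a p (P-d (A⇒B α a) (nonleaf w) q)
        ; fit   = λ _ a Pu Qu Pw Qw →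
            κ∉Q-nonleaf α nonleaf ∘ Q-restrict c ∘ Qu
          , (λ { q refl → κ∉QB (A⇒B α a) (Q-restrict c (Q-d (A⇒B α a) not-own-leaf (Qw q))) })
          , (λ { p q refl → κ∉PB (A⇒B α a) (subst (P c _) (starA α (P-restrict c (Pu p)))
                (P-restrict c (P-d (A⇒B α a) not-own-leaf (Pw q)))) }) }

      copies : ∀ u → Copy u
      copies u with cover u
      ... | inj₂ β = copy-B β
      ... | inj₁ α with any-finite? (finite G) (λ w → Leaf? w u)
      ...   | yes (_ , l) = copy-leaf α l
      ...   | no none     = copy-nonleaf α (λ w l → none (w , l))

      open module Copies (u : V) = Copy (copies u)

      open GlueAB (separated-weaken separated₂) copy d F
        (λ {u} α a → F∉Q u α a) (λ {u} α a → F∉Q-d u α a) (λ {u} α a → P∩P u α a)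

      base : Σ (Col 3 k) λ c → Extensible c
      base = glue , λ u → θ u , f u , λ α a → fit u α a {c′ = glue} {glue}
        (P-glue-A α) (Q-glue-A α) (P-glue-B (A⇒B α a)) (Q-glue-B (A⇒B α a))

  -- Distances and bounds for the injective chromatic index.

  W⇒Walk : ∀ {n} m {x y : Vec V n} → W m x y → ∃ λ ℓ → ℓ ≤ m × Walk (Sierpiński G n) x y ℓ
  W⇒Walk zero    refl               = 0 , z≤n , nil
  W⇒Walk (suc m) (inj₁ refl)        = 0 , z≤n , nil
  W⇒Walk (suc m) (inj₂ (z , e , w)) with ℓ , ℓ≤m , walk ← W⇒Walk m w =
    suc ℓ , s≤s ℓ≤m , cons (E⇒SAdj _ z e) walk

  distance⇒¬W : ∀ {n} m {x y : Vec V n} → DistanceAtLeast (Sierpiński G n) (suc m) x y → ¬ W m x y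
  distance⇒¬W m far w with ℓ , ℓ≤m , walk ← W⇒Walk m w =
    ℕₚ.1+n≰n (ℕₚ.≤-trans (far ℓ walk) ℓ≤m)

  restrict* : ∀ {k} → V → ∀ m → Col (3 + m) k → Col 3 k
  restrict* v zero    c = c
  restrict* v (suc m) c = restrict* v m (restrict c v)

  some-colour : ∀ {n k} → HasEdge G → InjectiveEdgeColouring (Sierpiński G (suc n)) k → Fin k
  some-colour {n} (v , t , a) c = InjectiveEdgeColouring.colour c (v ∷ t ^^ n) (t ∷ v ^^ n)
    (E⇒SAdj _ _ (inj₂ (a , refl , refl)))

  χᵢ′-colouring : ∀ H → InjectiveEdgeColouring H (χᵢ′ H)
  χᵢ′-colouring H = proj₁ (proj₂ (chromaticIndex-exists H))

  χᵢ′-least : ∀ {H k} → InjectiveEdgeColouring H k → χᵢ′ H ≤ k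
  χᵢ′-least {H} = proj₂ (proj₂ (chromaticIndex-exists H)) _

  lower : HasEdge G → ∀ m → χᵢ′ (Sierpiński G 3) ≤ χᵢ′ (Sierpiński G (3 + m))
  lower edge m = χᵢ′-least (fromCol (restrict* (proj₁ edge) m (toCol (some-colour edge c) c)))
    where
    c : InjectiveEdgeColouring (Sierpiński G (3 + m)) (χᵢ′ (Sierpiński G (3 + m)))
    c = χᵢ′-colouring _

  upper : HasEdge G → TriangleFree G → ∀ m →
          χᵢ′ (Sierpiński G (3 + m)) ≤ suc (χᵢ′ (Sierpiński G 3))
  upper edge tf m = χᵢ′-least (fromCol (proj₁
    -- The added colour `fromℕ _` is never a value of `inject₁`, hence far from every extreme
    -- vertex.
    (far-extend* tf (fromℕ _)
      (recode inject₁ Finₚ.inject₁-injective (toCol (some-colour edge c) c)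
        , λ _ _ _ _ _ → Finₚ.fromℕ≢inject₁ ∘ sym)
      m)))
    where
    c : InjectiveEdgeColouring (Sierpiński G 3) (χᵢ′ (Sierpiński G 3))
    c = χᵢ′-colouring _

  -- The given colour excludes `k = 0`.
  last-colour : ∀ {k} → Fin k → ∃ λ (κ : Fin k) → suc (toℕ κ) ≡ k
  last-colour {suc k} _ = fromℕ k , cong suc (Finₚ.toℕ-fromℕ k)

  module _ (edge : HasEdge G) (c : InjectiveEdgeColouring (Sierpiński G 3) (χᵢ′ (Sierpiński G 3))) where

    private
      default : Fin (χᵢ′ (Sierpiński G 3))
      default = some-colour edge c

      κ : Fin (χᵢ′ (Sierpiński G 3))
      κ = proj₁ (last-colour default)

      κ-last : ∀ {x y} (e : E x y) → extend default c x y ≡ κ → HasLastColour c x y (E⇒SAdj x y e)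
      κ-last e eq = trans (cong (suc ∘ toℕ) (trans (sym (extend-colour default c (E⇒SAdj _ _ e))) eq))
        (proj₂ (last-colour default))

      last-κ : ∀ {x y} (e : E x y) → HasLastColour c x y (E⇒SAdj x y e) → extend default c x y ≡ κ
      last-κ e eq = trans (extend-colour default c (E⇒SAdj _ _ e))
        (Finₚ.toℕ-injective (ℕₚ.suc-injective (trans eq (sym (proj₂ (last-colour default))))))

    upper-far : TriangleFree G →
      (∀ x y (e : SAdj G 3 x y) → HasLastColour c x y e →
        ∀ u → DistanceAtLeast (Sierpiński G 3) 3 x (extreme G 3 u)) →
      ∀ m → χᵢ′ (Sierpiński G (3 + m)) ≤ χᵢ′ (Sierpiński G 3)
    upper-far tf far m = χᵢ′-least (fromCol (proj₁ (far-extend* tf κ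
      (toCol default c , λ v z u w e eq →
        distance⇒¬W 2 (far z u _ (κ-last e eq) v) (W-sym 2 w))
      m)))

    upper-bipartite : (B : Bipartition G) →
      (∀ u → Bipartition.A B u → ∀ y (e : SAdj G 3 (extreme G 3 u) y) →
        HasLastColour c (extreme G 3 u) y e) →
      (∀ x y (e : SAdj G 3 x y) → HasLastColour c x y e →
        ∀ v → Bipartition.B B v → DistanceAtLeast (Sierpiński G 3) 2 x (extreme G 3 v)) →
      ∀ m → χᵢ′ (Sierpiński G (3 + m)) ≤ χᵢ′ (Sierpiński G 3)
    upper-bipartite B starA farB m = χᵢ′-least (fromCol (proj₁ (extend-bipartite*
      (Base.base (toCol default c) κ
        (λ { α (y , e , refl) → last-κ e (starA _ α y (E⇒SAdj _ y e)) })
        (λ { β (y , e , eq) → distance⇒¬W 1 (farB _ y _ (κ-last e eq) _ β) (inj₁ refl) })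
        -- The near end `y` is adjacent to the extreme vertex, which distance two forbids.
        (λ { β (y , z , e , e′ , _ , eq) →
          distance⇒¬W 1 (farB y z _ (κ-last e′ eq) _ β) (inj₂ (_ , E-sym e , refl)) }))
      m)))
      where open Bipartite B

mainTheorem6 : (G : Graph) → HasEdge G → TriangleFree G →
    (∀ (n : ℕ) → 3 ≤ n →
    χᵢ′ (Sierpiński G 3) ≤ χᵢ′ (Sierpiński G n) ×
    χᵢ′ (Sierpiński G n) ≤ χᵢ′ (Sierpiński G 3) + 1) ×
    (FarFromExtremes G ⊎ BipartiteCondition G →
    ∀ (n : ℕ) → 3 ≤ n → χᵢ′ (Sierpiński G n) ≡ χᵢ′ (Sierpiński G 3))
mainTheorem6 G edge tf = bounds , equal
  where
  bounds : ∀ n → 3 ≤ n →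
    χᵢ′ (Sierpiński G 3) ≤ χᵢ′ (Sierpiński G n) ×
    χᵢ′ (Sierpiński G n) ≤ χᵢ′ (Sierpiński G 3) + 1
  bounds (suc (suc (suc m))) (s≤s (s≤s (s≤s _))) =
    lower G edge m , ℕₚ.≤-trans (upper G edge tf m) (ℕₚ.≤-reflexive (ℕₚ.+-comm 1 _))

  equal : FarFromExtremes G ⊎ BipartiteCondition G →
    ∀ n → 3 ≤ n → χᵢ′ (Sierpiński G n) ≡ χᵢ′ (Sierpiński G 3)
  equal (inj₁ (c , far)) (suc (suc (suc m))) (s≤s (s≤s (s≤s _))) =
    ℕₚ.≤-antisym (upper-far G edge c tf far m) (lower G edge m)
  equal (inj₂ (B , c , starA , farB)) (suc (suc (suc m))) (s≤s (s≤s (s≤s _))) =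
    ℕₚ.≤-antisym (upper-bipartite G edge c B starA farB m) (lower G edge m)
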